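{- Let $S$ be a commutative semiring and $\Sigma$ an alphabet. A weighted language $s:\Sigma^*\to S$ is recognized by a WAFA over $S$ and $\Sigma$ if and only if its reversal $s^R$ is recognized by a polynomial automaton over $S$ and $\Sigma$.
   Context: An alphabet is a finite non-empty set; $\Sigma^*$ is the set of finite words over $\Sigma$, $\varepsilon$ the empty word. A semiring $(S,+,\cdot,0,1)$ has $(S,+,0)$ a commutative monoid, $(S,\cdot,1)$ a monoid, $0$ absorbing, and both distributive laws; it is commutative if $\cdot$ is commutative. For a finite linearly ordered set $X$ of $n$ indeterminates, $S[X]$ is the semiring of polynomials with coefficients in $S$ in these commuting indeterminates, and $p\langle s_1,\dots,s_n\rangle$ denotes simultaneous substitution of $s_i$ for the $i$-th indeterminate. The reversal of a word $w=w_1\cdots w_m$ is $w^R=w_m\cdots w_1$; the reversal of $s:\Sigma^*\to S$ is $s^R(w)=s(w^R)$. A weighted alternating finite automaton (WAFA) over $S$ and $\Sigma$ is $\mathcal A=(Q,\Sigma,\delta,P_0,\tau)$ with $Q=\{q_1,\dots,q_n\}$ a finite set of states, $\delta:Q\times\Sigma\to S[Q]$, $P_0\in S[Q]$, $\tau:Q\to S$. State behavior: $[\mathcal A]_q(\varepsilon)=\tau(q)$, $[\mathcal A]_q(av)=\delta(q,a)\langle[\mathcal A]_{q_1}(v),\dots,[\mathcal A]_{q_n}(v)\rangle$ for $a\in\Sigma$. Behavior: $[\![\mathcal A]\!](w)=P_0\langle[\mathcal A]_{q_1}(w),\dots,[\mathcal A]_{q_n}(w)\rangle$. A polynomial automaton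 over $S$ and $\Sigma$ is $\mathcal B=(n,\Sigma,\alpha,p,\gamma)$ with $n\in\mathbb N$, $\alpha\in S^n$, $p:\Sigma\to S[X_n]^n$ where $X_n=\{x_1,\dots,x_n\}$ (write $p_i(a)$ for the $i$-th entry of $p(a)$), and $\gamma\in S[X_n]$. State behavior, for $1\le i\le n$: $[\mathcal B]_i(\varepsilon)=\alpha_i$ and $[\mathcal B]_i(va)=p_i(a)\langle[\mathcal B]_1(v),\dots,[\mathcal B]_n(v)\rangle$ for $a\in\Sigma$. Behavior: $[\![\mathcal B]\!](w)=\gamma\langle[\mathcal B]_1(w),\dots,[\mathcal B]_n(w)\rangle$. An automaton recognizes $s:\Sigma^*\to S$ if its behavior equals $s$. -}

module Defs where

open import Algebra.Bundles using (CommutativeSemiring)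
import Algebra.Definitions.RawSemiring as RawSemiringDefinitions
open import Data.Fin.Base using (Fin)
open import Data.List.Base using (List; []; _∷_; foldr; reverse)
open import Data.List.Reverse using (Reverse; []; _∶_∶ʳ_; reverseView)
open import Data.Nat.Base using (ℕ; NonZero)
open import Data.Product.Base using (Σ-syntax; _×_; _,_)
open import Data.Vec.Functional using (Vector)
open import Function.Bundles using (_↔_; Inverse)
open import Function.Construct.Identity using (↔-id)
open import Level using (Level; 0ℓ; suc; _⊔_)

-- The enumeration also carries the linear order: the elements are
-- elem 0 < elem 1 < … < elem (size - 1).
record FiniteSet (a : Level) : Set (suc a) where
  field
    Elem        : Set a
    size        : ℕ
    enumeration : Fin size ↔ Elem

  elem : Fin size → Elem
  elem = Inverse.to enumeration

finiteSet : ℕ → FiniteSet 0ℓ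
finiteSet n = record { Elem = Fin n ; size = n ; enumeration = ↔-id (Fin n) }

record Alphabet (a : Level) : Set (suc a) where
  field
    letters : FiniteSet a

  open FiniteSet letters public renaming (Elem to Letter)

  field
    nonEmpty : NonZero size

Word : ∀ {a} → Alphabet a → Set a
Word A = List (Alphabet.Letter A)

module _ {c ℓ} (S : CommutativeSemiring c ℓ) where

  open CommutativeSemiring S
    using (Carrier; _≈_; _+_; _*_; 0#; rawSemiring)
  open RawSemiringDefinitions rawSemiring using (_^_; product)

  -- A polynomial is given as a finite formal sum of terms, each a coefficient
  -- together with the exponent of every indeterminate. The order of the terms
  -- is immaterial, a monomial may occur in several terms, whose coefficients
  -- then add up, and coefficients may be zero; substitution takes equal values
  -- on all the formal sums that denote the same polynomial. (Storing a normal
  -- form instead would need a decision procedure for being zero in S.)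
  Polynomial : ∀ {x} → FiniteSet x → Set (c ⊔ x)
  Polynomial X = List (Carrier × (FiniteSet.Elem X → ℕ))

  module _ {x} (X : FiniteSet x) where

    open FiniteSet X

    substitute : Polynomial X → Vector Carrier size → Carrier
    substitute p s =
      foldr (λ (k , e) r → k * product (λ i → s i ^ e (elem i)) + r) 0# p

  module _ {a} (A : Alphabet a) where

    open Alphabet A using (Letter)

    WeightedLanguage : Set (a ⊔ c)
    WeightedLanguage = Word A → Carrier

    reversal : WeightedLanguage → WeightedLanguage
    reversal s w = s (reverse w)

    record WAFA : Set (suc 0ℓ ⊔ a ⊔ c) where
      field
        Q : FiniteSet 0ℓ

      open FiniteSet Q public using () renaming (Elem to State; elem to q)

      field
        δ  : State → Letter → Polynomial Q
        P₀ : Polynomial Q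
        τ  : State → Carrier

      stateBehavior : State → Word A → Carrier
      stateBehavior r []      = τ r
      stateBehavior r (b ∷ v) =
        substitute Q (δ r b) (λ i → stateBehavior (q i) v)

      behavior : WeightedLanguage
      behavior w = substitute Q P₀ (λ i → stateBehavior (q i) w)

    record PolynomialAutomaton : Set (a ⊔ c) where
      field
        n : ℕ
        α : Vector Carrier n
        p : Letter → Vector (Polynomial (finiteSet n)) n
        γ : Polynomial (finiteSet n)

      -- The recursion removes letters from the end of the word, hence the
      -- Reverse view.
      stateBehaviorView : Fin n → ∀ {w} → Reverse w → Carrier
      stateBehaviorView i []            = α i
      stateBehaviorView i (_ ∶ v ∶ʳ b) =
        substitute (finiteSet n) (p b i) (λ j → stateBehaviorView j v)

      stateBehavior : Fin n → Word A → Carrier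
      stateBehavior i w = stateBehaviorView i (reverseView w)

      behavior : WeightedLanguage
      behavior w = substitute (finiteSet n) γ (λ i → stateBehavior i w)

    RecognizedByWAFA : WeightedLanguage → Set (suc 0ℓ ⊔ a ⊔ c ⊔ ℓ)
    RecognizedByWAFA s = Σ[ 𝓐 ∈ WAFA ] (∀ w → WAFA.behavior 𝓐 w ≈ s w)

    RecognizedByPolynomialAutomaton : WeightedLanguage → Set (a ⊔ c ⊔ ℓ)
    RecognizedByPolynomialAutomaton s =
      Σ[ 𝓑 ∈ PolynomialAutomaton ] (∀ w → PolynomialAutomaton.behavior 𝓑 w ≈ s w)

{-# OPTIONS --safe #-}
module Submission where

open import Defs
open import Algebra.Bundles using (CommutativeSemiring)
import Algebra.Properties.Monoid.Sum as MonoidSum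
import Algebra.Properties.Semiring.Exp as SemiringExp
open import Data.Fin.Base using (Fin)
open import Data.List.Base using ([]; _∷_; map; reverse)
open import Data.List.Properties using (reverse-++; reverse-involutive)
open import Data.List.Reverse using (Reverse; []; _∶_∶ʳ_; reverseView)
open import Data.Product.Base using (_,_; map₂)
open import Data.Vec.Functional using (Vector)
open import Function.Base using (_∘_)
open import Function.Bundles using (_⇔_; mk⇔)
open import Relation.Binary.PropositionalEquality as ≡ using (_≡_)

-- An alternating automaton and a polynomial automaton obey the same recursion,
-- the former reading words from the left and the latter from the right. Hence
-- the same data, with the states numbered, give an automaton of either kind,
-- and the state behaviors agree up to reversal of the word.

module _ {c ℓ} (S : CommutativeSemiring c ℓ) where

  open CommutativeSemiring S
  open MonoidSum *-monoid using () renaming (sum-cong-≋ to product-cong)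
  open SemiringExp semiring using (^-congˡ)

  module _ {x} (X : FiniteSet x) where

    open FiniteSet X

    substitute-cong : ∀ p {s t : Vector Carrier size} → (∀ i → s i ≈ t i) →
                      substitute S X p s ≈ substitute S X p t
    substitute-cong []            s≈t = refl
    substitute-cong ((k , e) ∷ p) s≈t =
      +-cong (*-congˡ (product-cong (λ i → ^-congˡ (e (elem i)) (s≈t i))))
             (substitute-cong p s≈t)

    number : Polynomial S X → Polynomial S (finiteSet size)
    number = map (map₂ (_∘ elem))

    -- `finiteSet` is enumerated by the identity, so corresponding terms have definitionally the
    -- same value and only the spine of the sum needs induction. The order of the states is
    -- preserved, so `s` itself stays as it is.
    substitute-number : ∀ p s → substitute S (finiteSet size) (number p) s ≡ substitute S X p s
    substitute-number []            s = ≡.refl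
    substitute-number ((k , e) ∷ p) s = ≡.cong (_ +_) (substitute-number p s)

  module _ {a} (A : Alphabet a) where

    module _ (𝓑 : PolynomialAutomaton S A) where

      open PolynomialAutomaton 𝓑

      module _ (g : Fin n → WeightedLanguage S A)
               (g-[] : ∀ i → g i [] ≈ α i)
               (g-∷  : ∀ i b v → g i (b ∷ v) ≈ substitute S (finiteSet n) (p b i) (λ j → g j v))
               where

        -- The recursion determines its solution, so any family `g` obeying it from the left will
        -- do; both directions of the theorem instantiate `g`. Quantifying over every view `v` makes
        -- the induction structural, since the tail of `reverseView w` is again just some view.
        stateBehaviorView-reverse : ∀ i {w} (v : Reverse w) →
                                    stateBehaviorView i v ≈ g i (reverse w)
        stateBehaviorView-reverse i []           = sym (g-[] i)
        stateBehaviorView-reverse i (w ∶ v ∶ʳ b) = trans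
          (substitute-cong (finiteSet n) (p b i) (λ j → stateBehaviorView-reverse j v))
          -- The last letter `b` becomes the first letter after reversal.
          (trans (sym (g-∷ i b (reverse w)))
                 (reflexive (≡.cong (g i) (≡.sym (reverse-++ w (b ∷ []))))))

        behavior-reverse : ∀ w → behavior w ≈ substitute S (finiteSet n) γ (λ i → g i (reverse w))
        behavior-reverse w =
          substitute-cong (finiteSet n) γ (λ i → stateBehaviorView-reverse i (reverseView w))

    toPolynomialAutomaton : WAFA S A → PolynomialAutomaton S A
    toPolynomialAutomaton 𝓐 = record
      { n = FiniteSet.size Q
      ; α = λ i → τ (q i)
      ; p = λ b i → number Q (δ (q i) b)
      ; γ = number Q P₀
      } where open WAFA 𝓐

    toPolynomialAutomaton-behavior : ∀ 𝓐 w →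
      PolynomialAutomaton.behavior (toPolynomialAutomaton 𝓐) w ≈ WAFA.behavior 𝓐 (reverse w)
    toPolynomialAutomaton-behavior 𝓐 w = trans
      (behavior-reverse (toPolynomialAutomaton 𝓐) (λ i → stateBehavior (q i))
        (λ i → refl)
        -- The WAFA substitutes into a polynomial over `Q`, the new automaton into its numbered
        -- copy.
        (λ i b v → reflexive (≡.sym (substitute-number Q (δ (q i) b) _)))
        w)
      (reflexive (substitute-number Q P₀ _))
      where open WAFA 𝓐

    toWAFA : PolynomialAutomaton S A → WAFA S A
    toWAFA 𝓑 = record
      { Q  = finiteSet n
      ; δ  = λ i b → p b i
      ; P₀ = γ
      ; τ  = α
      } where open PolynomialAutomaton 𝓑

    toWAFA-behavior : ∀ 𝓑 w →
      PolynomialAutomaton.behavior 𝓑 w ≈ WAFA.behavior (toWAFA 𝓑) (reverse w)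
    toWAFA-behavior 𝓑 =
      -- With `Fin n` as state set, `q` is the identity, so both recursion equations hold by
      -- computation.
      behavior-reverse 𝓑 (WAFA.stateBehavior (toWAFA 𝓑)) (λ i → refl) (λ i b v → refl)

lemma8p1 : ∀ {c ℓ a} (S : CommutativeSemiring c ℓ) (A : Alphabet a) (s : WeightedLanguage S A) →
    RecognizedByWAFA S A s ⇔ RecognizedByPolynomialAutomaton S A (reversal S A s)
lemma8p1 S A s = mk⇔
  (λ (𝓐 , 𝓐≈s) → toPolynomialAutomaton S A 𝓐 ,
    λ w → trans (toPolynomialAutomaton-behavior S A 𝓐 w) (𝓐≈s (reverse w)))
  (λ (𝓑 , 𝓑≈sᴿ) → toWAFA S A 𝓑 ,
    -- The hypothesis at `reverse w` yields the claim at `reverse (reverse w)`; both sides are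
    -- transported to `w` together.
    λ w → ≡.subst (λ u → WAFA.behavior (toWAFA S A 𝓑) u ≈ s u) (reverse-involutive w)
      (trans (sym (toWAFA-behavior S A 𝓑 (reverse w))) (𝓑≈sᴿ (reverse w))))
  where open CommutativeSemiring S
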